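{- Let $\theta$ be an irrational real number. For integers $j\geq0$ and real $t>0$ define $$\tau_j(t)=-(-1)^j\,\frac{q_{j-1}-(-1)^j\frac{4i\pi t}{q_{j-2}+\theta_jq_{j-1}}}{q_j+(-1)^j\frac{4i\pi t}{q_{j-1}+\theta_{j+1}q_j}}.$$ Then for all $j\geq0$ and $t>0$, $$\bigl(\tau_j(t)-(-1)^ja_{j+1}\bigr)\,\tau_{j+1}(t)=-1.$$
   Context: Continued fraction notation for irrational $\theta$: $\theta_0=\theta$, $a_k=\lfloor\theta_k\rfloor$, $\theta_{k}=\frac{1}{\theta_{k-1}-a_{k-1}}$ for $k\geq1$. Denominators of convergents: $q_{ -2}=1$, $q_{ -1}=0$, $q_k=q_{k-2}+a_kq_{k-1}$ for $k\geq0$. -}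

module Defs where

open import Level using (_⊔_)
import Level
open import Algebra.Apartness.Bundles using (HeytingField)
open import Algebra.Bundles using (CommutativeRing)
import Algebra.Definitions.RawMonoid as RawMonoid
open import Data.Empty using (⊥-elim)
open import Data.Maybe.Base using (Maybe; just; nothing)
open import Data.Nat.Base as ℕ using (ℕ; zero; suc; z≤n; s≤s)
import Data.Nat.Properties as ℕₚ
open import Data.Integer.Base as ℤ using (ℤ; +_; -[1+_]; +[1+_]; +0; 0ℤ; 1ℤ)
import Data.Integer.Properties as ℤₚ
open import Data.Product.Base using (∃; _×_; _,_; proj₁; proj₂)
open import Data.Sign.Base as Sign using (Sign)
open import Data.Sum.Base using (_⊎_; inj₁; inj₂)
open import Relation.Binary.Core using (Rel)
open import Relation.Binary.Structures using (IsStrictPartialOrder)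
import Relation.Binary.PropositionalEquality.Core as ≡
open ≡ using (_≡_)
open import Relation.Nullary.Decidable.Core using (yes; no)
open import Relation.Nullary.Negation.Core using (¬_)

-- The real numbers, given by the axioms of a Cauchy complete Archimedean
-- ordered field.  Classically these axioms have exactly one model up to
-- isomorphism, the field ℝ.  They are phrased with an apartness _#_, classically
-- the same as ≉, so that constructively the Cauchy reals satisfy them too.

record RealNumbers c ℓ₁ ℓ₂ : Set (Level.suc (c ⊔ ℓ₁ ⊔ ℓ₂)) where
  infix 4 _<_
  field
    heytingField : HeytingField c ℓ₁ ℓ₂

  open HeytingField heytingField public
    renaming (refl to ≈-refl; sym to ≈-sym; trans to ≈-trans; reflexive to ≈-reflexive)

  commutativeRing : CommutativeRing c ℓ₁
  commutativeRing = record { isCommutativeRing = isCommutativeRing }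

  fromℕ : ℕ → Carrier
  fromℕ n = RawMonoid._×′_ (CommutativeRing.+-rawMonoid commutativeRing) n 1#

  field
    _<_                  : Rel Carrier ℓ₂
    isStrictPartialOrder : IsStrictPartialOrder _≈_ _<_
    #⇒<                  : ∀ {x y} → x # y → x < y ⊎ y < x
    <⇒#                  : ∀ {x y} → x < y → x # y
    +-monoˡ-<            : ∀ {x y} z → x < y → x + z < y + z
    *-pos                : ∀ {x y} → 0# < x → 0# < y → 0# < x * y
    archimedean          : ∀ x → ∃ λ n → x < fromℕ n

  open IsStrictPartialOrder isStrictPartialOrder public
    using (<-respʳ-≈; <-respˡ-≈) renaming (irrefl to <-irrefl; trans to <-trans)

  -- |x - y| < ε
  Close : Carrier → Carrier → Carrier → Set ℓ₂
  Close ε x y = x - y < ε × y - x < ε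

  IsCauchy : (ℕ → Carrier) → Set (c ⊔ ℓ₂)
  IsCauchy s = ∀ ε → 0# < ε →
    ∃ λ N → ∀ m n → N ℕ.≤ m → N ℕ.≤ n → Close ε (s m) (s n)

  _ConvergesTo_ : (ℕ → Carrier) → Carrier → Set (c ⊔ ℓ₂)
  s ConvergesTo l = ∀ ε → 0# < ε → ∃ λ N → ∀ n → N ℕ.≤ n → Close ε (s n) l

  field
    complete : ∀ s → IsCauchy s → ∃ λ l → s ConvergesTo l

module Real {c ℓ₁ ℓ₂} (R : RealNumbers c ℓ₁ ℓ₂) where
  open RealNumbers R public

  private
    module CR = CommutativeRing commutativeRing
    semiring = CR.semiring

  open import Algebra.Properties.Semiring.Exp semiring public using (_^_)
  open import Algebra.Properties.Semiring.Mult.TCOptimised semiring using (1+×; ×-homo-+; ×1-homo-*)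
  open import Algebra.Properties.Ring CR.ring
    using (-0#≈0#; -‿involutive; -‿distribˡ-*; -‿distribʳ-*; -‿+-comm)
  open import Relation.Binary.Reasoning.Setoid setoid

  fromℤ : ℤ → Carrier
  fromℤ (+ n)    = fromℕ n
  fromℤ -[1+ n ] = - fromℕ (suc n)

  fromℤ-neg : ∀ i → fromℤ (ℤ.- i) ≈ - fromℤ i
  fromℤ-neg +0       = ≈-sym -0#≈0#
  fromℤ-neg +[1+ n ] = ≈-refl
  fromℤ-neg -[1+ n ] = ≈-sym (-‿involutive _)

  private
    cancel-1 : ∀ x y → (1# + x) - (1# + y) ≈ x - y
    cancel-1 x y = begin
      (1# + x) + - (1# + y)     ≈⟨ +-congˡ (-‿+-comm 1# y) ⟨
      (1# + x) + (- 1# + - y)   ≈⟨ +-congʳ (+-comm 1# x) ⟩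
      (x + 1#) + (- 1# + - y)   ≈⟨ +-assoc x 1# _ ⟩
      x + (1# + (- 1# + - y))   ≈⟨ +-congˡ (+-assoc 1# (- 1#) (- y)) ⟨
      x + ((1# + - 1#) + - y)   ≈⟨ +-congˡ (+-congʳ (-‿inverseʳ 1#)) ⟩
      x + (0# + - y)            ≈⟨ +-congˡ (+-identityˡ (- y)) ⟩
      x + - y                   ∎

  fromℤ-⊖ : ∀ m n → fromℤ (m ℤ.⊖ n) ≈ fromℕ m - fromℕ n
  fromℤ-⊖ zero    zero    = ≈-sym (-‿inverseʳ 0#)
  fromℤ-⊖ zero    (suc n) = ≈-sym (+-identityˡ _)
  fromℤ-⊖ (suc m) zero    = ≈-sym (≈-trans (+-congˡ -0#≈0#) (+-identityʳ _))
  fromℤ-⊖ (suc m) (suc n) = begin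
    fromℤ (suc m ℤ.⊖ suc n)          ≡⟨ ≡.cong fromℤ (ℤₚ.[1+m]⊖[1+n]≡m⊖n m n) ⟩
    fromℤ (m ℤ.⊖ n)                  ≈⟨ fromℤ-⊖ m n ⟩
    fromℕ m - fromℕ n                ≈⟨ cancel-1 _ _ ⟨
    (1# + fromℕ m) - (1# + fromℕ n)  ≈⟨ +-cong (1+× m 1#) (-‿cong (1+× n 1#)) ⟨
    fromℕ (suc m) - fromℕ (suc n)    ∎

  fromℤ-+ : ∀ i j → fromℤ (i ℤ.+ j) ≈ fromℤ i + fromℤ j
  fromℤ-+ (+ m)    (+ n)    = ×-homo-+ 1# m n
  fromℤ-+ (+ m)    -[1+ n ] = fromℤ-⊖ m (suc n)
  fromℤ-+ -[1+ m ] (+ n)    = ≈-trans (fromℤ-⊖ n (suc m)) (+-comm _ _)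
  fromℤ-+ -[1+ m ] -[1+ n ] = begin
    - fromℕ (suc (suc (m ℕ.+ n)))     ≡⟨ ≡.cong (λ k → - fromℕ (suc k)) (ℕₚ.+-suc m n) ⟨
    - fromℕ (suc m ℕ.+ suc n)         ≈⟨ -‿cong (×-homo-+ 1# (suc m) (suc n)) ⟩
    - (fromℕ (suc m) + fromℕ (suc n)) ≈⟨ -‿+-comm _ _ ⟨
    - fromℕ (suc m) - fromℕ (suc n)   ∎

  private
    fromℤ-+◃ : ∀ n → fromℤ (Sign.+ ℤ.◃ n) ≈ fromℕ n
    fromℤ-+◃ zero    = ≈-refl
    fromℤ-+◃ (suc n) = ≈-refl

    fromℤ--◃ : ∀ n → fromℤ (Sign.- ℤ.◃ n) ≈ - fromℕ n
    fromℤ--◃ zero    = ≈-sym -0#≈0#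
    fromℤ--◃ (suc n) = ≈-refl

  fromℤ-* : ∀ i j → fromℤ (i ℤ.* j) ≈ fromℤ i * fromℤ j
  fromℤ-* (+ m)    (+ n)    = ≈-trans (fromℤ-+◃ (m ℕ.* n)) (×1-homo-* m n)
  fromℤ-* (+ m)    -[1+ n ] =
    ≈-trans (fromℤ--◃ (m ℕ.* suc n)) (≈-trans (-‿cong (×1-homo-* m (suc n))) (-‿distribʳ-* _ _))
  fromℤ-* -[1+ m ] (+ n)    =
    ≈-trans (fromℤ--◃ (suc m ℕ.* n)) (≈-trans (-‿cong (×1-homo-* (suc m) n)) (-‿distribˡ-* _ _))
  fromℤ-* -[1+ m ] -[1+ n ] = begin
    fromℕ (suc m ℕ.* suc n)            ≈⟨ ×1-homo-* (suc m) (suc n) ⟩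
    fromℕ (suc m) * fromℕ (suc n)      ≈⟨ -‿involutive _ ⟨
    - - (fromℕ (suc m) * fromℕ (suc n)) ≈⟨ -‿cong (-‿distribʳ-* _ _) ⟩
    - (fromℕ (suc m) * - fromℕ (suc n)) ≈⟨ -‿distribˡ-* _ _ ⟩
    - fromℕ (suc m) * - fromℕ (suc n)   ∎

  private
    open import Algebra.Solver.Ring.AlmostCommutativeRing
      using (AlmostCommutativeRing; fromCommutativeRing; _-Raw-AlmostCommutative⟶_)

    acr : AlmostCommutativeRing c ℓ₁
    acr = fromCommutativeRing commutativeRing

    ℤ⟶R : ℤ.+-*-rawRing -Raw-AlmostCommutative⟶ acr
    ℤ⟶R = record
      { ⟦_⟧    = fromℤ
      ; +-homo = fromℤ-+
      ; *-homo = fromℤ-*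
      ; -‿homo = fromℤ-neg
      ; 0-homo = ≈-refl
      ; 1-homo = ≈-refl
      }

    _coeff≟_ : ∀ i j → Maybe (fromℤ i ≈ fromℤ j)
    i coeff≟ j with i ℤₚ.≟ j
    ... | yes i≡j = just (≈-reflexive (≡.cong fromℤ i≡j))
    ... | no  _   = nothing

  module RingSolver where
    open import Algebra.Solver.Ring ℤ.+-*-rawRing acr ℤ⟶R _coeff≟_ public
  open RingSolver using (solve; _:+_; _:*_; _:-_; :-_; _:=_; con)

  <-from-pos : ∀ {x y e} → 0# < e → e ≈ y - x → x < y
  <-from-pos {x} {y} {e} 0<e e≈ =
    <-respˡ-≈ (+-identityˡ x)
      (<-respʳ-≈ (≈-trans (+-congʳ e≈) (solve 2 (λ x y → (y :- x) :+ x := y) ≈-refl x y))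
        (+-monoˡ-< x 0<e))

  <⇒pos : ∀ {x y} → x < y → 0# < y - x
  <⇒pos {x} x<y = <-respˡ-≈ (-‿inverseʳ x) (+-monoˡ-< (- x) x<y)

  +-pos : ∀ {x y} → 0# < x → 0# < y → 0# < x + y
  +-pos {x} {y} 0<x 0<y =
    <-trans 0<y (<-respˡ-≈ (+-identityˡ y) (+-monoˡ-< y 0<x))

  neg-pos : ∀ {x} → x < 0# → 0# < - x
  neg-pos {x} x<0 = <-respʳ-≈ (+-identityˡ (- x)) (<⇒pos x<0)

  *-monoˡ-< : ∀ {x y z} → 0# < z → x < y → z * x < z * y
  *-monoˡ-< {x} {y} {z} 0<z x<y = <-from-pos (*-pos 0<z (<⇒pos x<y))
    (solve 3 (λ x y z → z :* (y :- x) := z :* y :- z :* x) ≈-refl x y z)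

  <-asym : ∀ {x y} → x < y → ¬ (y < x)
  <-asym x<y y<x = <-irrefl ≈-refl (<-trans x<y y<x)

  private
    x-0≈x : ∀ x → x - 0# ≈ x
    x-0≈x x = solve 1 (λ x → x :- con 0ℤ := x) ≈-refl x

  >0⇒# : ∀ {x} → 0# < x → x # 0#
  >0⇒# 0<x = #-sym (<⇒# 0<x)

  -- In a Heyting field, x # 0 makes x - 0 (rather than x) invertible.
  infixl 8 _⁻¹[_]
  _⁻¹[_] : ∀ x → x # 0# → Carrier
  x ⁻¹[ x#0 ] = proj₁ (#⇒invertible x#0)

  *-inverseʳ : ∀ x (x#0 : x # 0#) → x * x ⁻¹[ x#0 ] ≈ 1#
  *-inverseʳ x x#0 =
    ≈-trans (*-congʳ (≈-sym (x-0≈x x))) (proj₂ (proj₂ (#⇒invertible x#0)))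

  infixl 7 _/_[_]
  _/_[_] : ∀ x y → y # 0# → Carrier
  x / y [ y#0 ] = x * y ⁻¹[ y#0 ]

  xy≈1⇒x#0 : ∀ {x y} → x * y ≈ 1# → x # 0#
  xy≈1⇒x#0 {x} {y} xy≈1 = invertible⇒#
    (y , ≈-trans (*-congˡ (x-0≈x x)) (≈-trans (*-comm y x) xy≈1)
       , ≈-trans (*-congʳ (x-0≈x x)) xy≈1)

  ²-nonneg : ∀ x → ¬ (x * x < 0#)
  ²-nonneg x xx<0 with #⇒< x#0
    where
    xx#0 : x * x # 0#
    xx#0 = <⇒# xx<0
    x#0 : x # 0#
    x#0 = xy≈1⇒x#0 (≈-trans (≈-sym (*-assoc x x _)) (*-inverseʳ (x * x) xx#0))
  ... | inj₂ 0<x = <-asym xx<0 (*-pos 0<x 0<x)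
  ... | inj₁ x<0 = <-asym xx<0
    (<-respʳ-≈ (solve 1 (λ x → (:- x) :* (:- x) := x :* x) ≈-refl x)
      (*-pos (neg-pos x<0) (neg-pos x<0)))

  ²-pos : ∀ {x} → x # 0# → 0# < x * x
  ²-pos {x} x#0 with #⇒< x#0
  ... | inj₂ 0<x = *-pos 0<x 0<x
  ... | inj₁ x<0 = <-respʳ-≈ (solve 1 (λ x → (:- x) :* (:- x) := x :* x) ≈-refl x)
      (*-pos (neg-pos x<0) (neg-pos x<0))

  0<1 : 0# < 1#
  0<1 = <-respʳ-≈ (*-identityˡ 1#) (²-pos (xy≈1⇒x#0 (*-identityˡ 1#)))

  fromℕ-pos : ∀ n → 0# < fromℕ (suc n)
  fromℕ-pos zero    = 0<1
  fromℕ-pos (suc n) = <-respʳ-≈ (≈-sym (1+× (suc n) 1#)) (+-pos 0<1 (fromℕ-pos n))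

  fromℤ-pos : ∀ {i} → 0ℤ ℤ.< i → 0# < fromℤ i
  fromℤ-pos {+[1+ n ]} _ = fromℕ-pos n
  fromℤ-pos {+0} (ℤ.+<+ ())

  fromℤ-pos⁻¹ : ∀ {i} → 0# < fromℤ i → 0ℤ ℤ.< i
  fromℤ-pos⁻¹ {+0}       0<0 = ⊥-elim (<-irrefl ≈-refl 0<0)
  fromℤ-pos⁻¹ {+[1+ n ]} _   = ℤ.+<+ (s≤s z≤n)
  fromℤ-pos⁻¹ { -[1+ n ]} 0<i =
    ⊥-elim (<-irrefl (≈-sym (-‿inverseʳ _)) (+-pos (fromℕ-pos n) 0<i))

  ⁻¹-pos : ∀ {x} → 0# < x → (x#0 : x # 0#) → 0# < x ⁻¹[ x#0 ]
  ⁻¹-pos {x} 0<x x#0 with #⇒< (xy≈1⇒x#0 (≈-trans (*-comm _ x) (*-inverseʳ x x#0)))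
  ... | inj₂ 0<x⁻¹ = 0<x⁻¹
  ... | inj₁ x⁻¹<0 = ⊥-elim (<-asym 0<1
    (<-respʳ-≈ (zeroʳ x) (<-respˡ-≈ (*-inverseʳ x x#0) (*-monoˡ-< 0<x x⁻¹<0))))

  -- π, as the sum of the Leibniz series Σ (-1)^k · 4 / (2k + 1).

  leibnizTerm : ℕ → Carrier
  leibnizTerm k = fromℕ 4 / fromℕ (suc (2 ℕ.* k)) [ >0⇒# (fromℕ-pos (2 ℕ.* k)) ]

  leibniz : ℕ → Carrier
  leibniz zero    = 0#
  leibniz (suc n) = leibniz n + (- 1#) ^ n * leibnizTerm n

  fromℕ-mono-< : ∀ m k → fromℕ m < fromℕ (m ℕ.+ suc k)
  fromℕ-mono-< m k = <-from-pos (fromℕ-pos k) (begin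
    fromℕ (suc k)                       ≈⟨ solve 2 (λ x y → y := (x :+ y) :- x) ≈-refl (fromℕ m) _ ⟩
    (fromℕ m + fromℕ (suc k)) - fromℕ m ≈⟨ +-congʳ (×-homo-+ 1# m (suc k)) ⟨
    fromℕ (m ℕ.+ suc k) - fromℕ m       ∎)

  ⁻¹-anti-< : ∀ {x y} → 0# < x → x < y → (x#0 : x # 0#) (y#0 : y # 0#) → y ⁻¹[ y#0 ] < x ⁻¹[ x#0 ]
  ⁻¹-anti-< {x} {y} 0<x x<y x#0 y#0 =
    <-respˡ-≈ (begin
      (x′ * y′) * x ≈⟨ solve 3 (λ x′ y′ x → (x′ :* y′) :* x := y′ :* (x :* x′)) ≈-refl x′ y′ x ⟩
      y′ * (x * x′) ≈⟨ *-congˡ (*-inverseʳ x x#0) ⟩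
      y′ * 1#       ≈⟨ *-identityʳ y′ ⟩
      y′            ∎)
    (<-respʳ-≈ (begin
      (x′ * y′) * y ≈⟨ *-assoc x′ y′ y ⟩
      x′ * (y′ * y) ≈⟨ *-congˡ (*-comm y′ y) ⟩
      x′ * (y * y′) ≈⟨ *-congˡ (*-inverseʳ y y#0) ⟩
      x′ * 1#       ≈⟨ *-identityʳ x′ ⟩
      x′            ∎)
    (*-monoˡ-< (*-pos (⁻¹-pos 0<x x#0) (⁻¹-pos (<-trans 0<x x<y) y#0)) x<y))
    where
    x′ y′ : Carrier
    x′ = x ⁻¹[ x#0 ]
    y′ = y ⁻¹[ y#0 ]

  leibnizTerm-pos : ∀ n → 0# < leibnizTerm n
  leibnizTerm-pos n = *-pos (fromℕ-pos 3) (⁻¹-pos (fromℕ-pos (2 ℕ.* n)) _)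

  leibnizTerm-decreasing : ∀ n → leibnizTerm (suc n) < leibnizTerm n
  leibnizTerm-decreasing n = *-monoˡ-< (fromℕ-pos 3)
    (⁻¹-anti-< (fromℕ-pos (2 ℕ.* n))
      (≡.subst (λ k → fromℕ (suc (2 ℕ.* n)) < fromℕ k) 2n+3 (fromℕ-mono-< (suc (2 ℕ.* n)) 1)) _ _)
    where
    2n+3 : suc (2 ℕ.* n) ℕ.+ 2 ≡ suc (2 ℕ.* suc n)
    2n+3 = ≡.cong suc (≡.trans (ℕₚ.+-comm (2 ℕ.* n) 2) (≡.sym (ℕₚ.*-suc 2 n)))

  private
    tail : ℕ → ℕ → Carrier
    tail n zero    = 0#
    tail n (suc k) = leibnizTerm n - tail (suc n) k

    leibniz-split : ∀ k n → leibniz (k ℕ.+ n) ≈ leibniz n + (- 1#) ^ n * tail n k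
    leibniz-split zero    n =
      solve 2 (λ x s → x := x :+ s :* con 0ℤ) ≈-refl (leibniz n) ((- 1#) ^ n)
    leibniz-split (suc k) n = begin
      leibniz (suc k ℕ.+ n)  ≡⟨ ≡.cong leibniz (ℕₚ.+-suc k n) ⟨
      leibniz (k ℕ.+ suc n)  ≈⟨ leibniz-split k (suc n) ⟩
      leibniz n + (- 1#) ^ n * leibnizTerm n + (- 1# * (- 1#) ^ n) * tail (suc n) k
        ≈⟨ solve 4 (λ x s t a → x :+ s :* t :+ ((:- con 1ℤ) :* s) :* a := x :+ s :* (t :- a))
             ≈-refl (leibniz n) ((- 1#) ^ n) (leibnizTerm n) (tail (suc n) k) ⟩
      leibniz n + (- 1#) ^ n * (leibnizTerm n - tail (suc n) k) ∎

    tail-bound : ∀ {δ} → 0# < δ → ∀ n k → (0# < tail n k + δ) × (0# < (leibnizTerm n + δ) - tail n k)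
    tail-bound {δ} 0<δ n zero =
        <-respʳ-≈ (≈-sym (+-identityˡ δ)) 0<δ
      , <-respʳ-≈ (≈-sym (x-0≈x _)) (+-pos (leibnizTerm-pos n) 0<δ)
    tail-bound {δ} 0<δ n (suc k) with tail-bound 0<δ (suc n) k
    ... | lower , upper =
        <-respʳ-≈ (solve 4 (λ t t′ d a → ((t′ :+ d) :- a) :+ (t :- t′) := (t :- a) :+ d)
                     ≈-refl t (leibnizTerm (suc n)) δ a)
          (+-pos upper (<⇒pos (leibnizTerm-decreasing n)))
      , <-respʳ-≈ (solve 3 (λ t d a → a :+ d := (t :+ d) :- (t :- a)) ≈-refl t δ a) lower
      where
      t a : Carrier
      t = leibnizTerm n
      a = tail (suc n) k

    sign-bound : ∀ {b x} n → 0# < b - x → 0# < b + x →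
                 (0# < b - (- 1#) ^ n * x) × (0# < b + (- 1#) ^ n * x)
    sign-bound {b} {x} zero    p q =
        <-respʳ-≈ (+-congˡ (-‿cong (≈-sym (*-identityˡ x)))) p
      , <-respʳ-≈ (+-congˡ (≈-sym (*-identityˡ x))) q
    sign-bound {b} {x} (suc n) p q with sign-bound n p q
    ... | p′ , q′ =
        <-respʳ-≈ (solve 3 (λ b s x → b :+ s :* x := b :- ((:- con 1ℤ) :* s) :* x)
                     ≈-refl b ((- 1#) ^ n) x) q′
      , <-respʳ-≈ (solve 3 (λ b s x → b :- s :* x := b :+ ((:- con 1ℤ) :* s) :* x)
                     ≈-refl b ((- 1#) ^ n) x) p′

    -- |leibniz (k + n) - leibniz n| < 2 · leibnizTerm n
    leibniz-bound : ∀ n k →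
      let b = leibnizTerm n + leibnizTerm n; d = leibniz (k ℕ.+ n) - leibniz n
      in (0# < b - d) × (0# < b + d)
    leibniz-bound n k with tail-bound (leibnizTerm-pos n) n k
    ... | lower , upper with sign-bound {leibnizTerm n + leibnizTerm n} {tail n k} n upper
                              (<-respʳ-≈ (solve 2 (λ t a → (a :+ t) :+ t := (t :+ t) :+ a) ≈-refl
                                           (leibnizTerm n) (tail n k))
                                (+-pos lower (leibnizTerm-pos n)))
    ... | p , q = <-respʳ-≈ (+-congˡ (-‿cong d≈)) p , <-respʳ-≈ (+-congˡ d≈) q
      where
      d≈ : (- 1#) ^ n * tail n k ≈ leibniz (k ℕ.+ n) - leibniz n
      d≈ = ≈-trans (solve 2 (λ x y → y := (x :+ y) :- x) ≈-refl (leibniz n) _)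
                   (+-congʳ (≈-sym (leibniz-split k n)))

    small : ∀ s ε → 0# < ε → ∃ λ N →
      let t = s / fromℕ (suc (2 ℕ.* N)) [ >0⇒# (fromℕ-pos (2 ℕ.* N)) ] in (t + t) + (t + t) < ε
    small s ε 0<ε = N ,
      <-respˡ-≈ (solve 2 (λ d s → d :* ((s :+ s) :+ (s :+ s)) := (s :* d :+ s :* d) :+ (s :* d :+ s :* d))
                   ≈-refl D′ s)
      (<-respʳ-≈ (begin
        D′ * (ε * D)              ≈⟨ solve 3 (λ d′ e d → d′ :* (e :* d) := e :* (d :* d′)) ≈-refl D′ ε D ⟩
        ε * (D * D′)              ≈⟨ *-congˡ (*-inverseʳ D D#0) ⟩
        ε * 1#                    ≈⟨ *-identityʳ ε ⟩
        ε                         ∎)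
      (*-monoˡ-< (⁻¹-pos D>0 D#0) 4s<εD))
      where
      ε#0 : ε # 0#
      ε#0 = >0⇒# 0<ε
      4s ε′ : Carrier
      4s = (s + s) + (s + s)
      ε′ = ε ⁻¹[ ε#0 ]
      bound : ∃ λ N → 4s * ε′ < fromℕ N
      bound = archimedean (4s * ε′)
      N : ℕ
      N = proj₁ bound
      D : Carrier
      D = fromℕ (suc (2 ℕ.* N))
      D>0 : 0# < D
      D>0 = fromℕ-pos (2 ℕ.* N)
      D#0 : D # 0#
      D#0 = >0⇒# D>0
      D′ : Carrier
      D′ = D ⁻¹[ D#0 ]
      N<D : fromℕ N < D
      N<D = ≡.subst (λ k → fromℕ N < fromℕ k) (ℕₚ.+-suc N (N ℕ.+ 0)) (fromℕ-mono-< N (N ℕ.+ 0))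
      4s<εD : 4s < ε * D
      4s<εD = <-respˡ-≈ (begin
        ε * (4s * ε′)   ≈⟨ solve 3 (λ e s e′ → e :* (s :* e′) := s :* (e :* e′)) ≈-refl ε 4s ε′ ⟩
        4s * (ε * ε′)   ≈⟨ *-congˡ (*-inverseʳ ε ε#0) ⟩
        4s * 1#         ≈⟨ *-identityʳ _ ⟩
        4s              ∎)
        (*-monoˡ-< 0<ε (<-trans (proj₂ bound) N<D))

    leibnizTerm-small : ∀ ε → 0# < ε → ∃ λ N →
      (leibnizTerm N + leibnizTerm N) + (leibnizTerm N + leibnizTerm N) < ε
    leibnizTerm-small = small (fromℕ 4)

    leibniz-bound′ : ∀ {N m} → N ℕ.≤ m →
      let b = leibnizTerm N + leibnizTerm N; d = leibniz m - leibniz N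
      in (0# < b - d) × (0# < b + d)
    leibniz-bound′ {N} {m} N≤m =
      ≡.subst (λ k → let b = leibnizTerm N + leibnizTerm N; d = leibniz k - leibniz N
                     in (0# < b - d) × (0# < b + d))
        (ℕₚ.m∸n+n≡m N≤m) (leibniz-bound N (m ℕ.∸ N))

    triangle : ∀ {b x y z} → 0# < b - (x - z) → 0# < b + (y - z) → x - y < b + b
    triangle {b} {x} {y} {z} p q = <-from-pos (+-pos p q)
      (solve 4 (λ b x y z → (b :- (x :- z)) :+ (b :+ (y :- z)) := (b :+ b) :- (x :- y))
        ≈-refl b x y z)

  leibniz-cauchy : IsCauchy leibniz
  leibniz-cauchy ε 0<ε =
    N , λ m n N≤m N≤n → half m n N≤m N≤n , half n m N≤n N≤m
    where
    N : ℕ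
    N = proj₁ (leibnizTerm-small ε 0<ε)
    half : ∀ m n → N ℕ.≤ m → N ℕ.≤ n → leibniz m - leibniz n < ε
    half m n N≤m N≤n = <-trans
      (triangle (proj₁ (leibniz-bound′ N≤m)) (proj₂ (leibniz-bound′ N≤n)))
      (proj₂ (leibnizTerm-small ε 0<ε))

  π : Carrier
  π = proj₁ (complete leibniz leibniz-cauchy)

  -- The fractions p / q range over all integers p and all q ≥ 1 (q = suc n).
  -- Apartness, rather than mere inequality, tells on which side of p / q the
  -- number x lies, which is what makes its floor computable.
  Irrational : Carrier → Set ℓ₂
  Irrational x = ∀ p n → x # fromℤ p / fromℕ (suc n) [ >0⇒# (fromℕ-pos n) ]

  irrational⇒< : ∀ {x} → Irrational x → ∀ p n →
    fromℕ (suc n) * x < fromℤ p ⊎ fromℤ p < fromℕ (suc n) * x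
  irrational⇒< {x} irr p n = from (#⇒< (irr p n))
    where
    q : Carrier
    q = fromℕ (suc n)
    q#0 : q # 0#
    q#0 = >0⇒# (fromℕ-pos n)
    q*[p/q]≈p : q * (fromℤ p / q [ q#0 ]) ≈ fromℤ p
    q*[p/q]≈p = begin
      q * (fromℤ p * q ⁻¹[ q#0 ]) ≈⟨ solve 3 (λ q p q′ → q :* (p :* q′) := p :* (q :* q′))
                                       ≈-refl q (fromℤ p) (q ⁻¹[ q#0 ]) ⟩
      fromℤ p * (q * q ⁻¹[ q#0 ]) ≈⟨ *-congˡ (*-inverseʳ q q#0) ⟩
      fromℤ p * 1#                ≈⟨ *-identityʳ _ ⟩
      fromℤ p                     ∎
    from : x < fromℤ p / q [ q#0 ] ⊎ fromℤ p / q [ q#0 ] < x → q * x < fromℤ p ⊎ fromℤ p < q * x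
    from (inj₁ x<p/q) = inj₁ (<-respʳ-≈ q*[p/q]≈p (*-monoˡ-< (fromℕ-pos n) x<p/q))
    from (inj₂ p/q<x) = inj₂ (<-respˡ-≈ q*[p/q]≈p (*-monoˡ-< (fromℕ-pos n) p/q<x))

  irrational⇐< : ∀ {x} → (∀ p n → fromℕ (suc n) * x < fromℤ p ⊎ fromℤ p < fromℕ (suc n) * x) →
    Irrational x
  irrational⇐< {x} h p n = from (h p n)
    where
    q : Carrier
    q = fromℕ (suc n)
    q#0 : q # 0#
    q#0 = >0⇒# (fromℕ-pos n)
    q′ : Carrier
    q′ = q ⁻¹[ q#0 ]
    q′>0 : 0# < q′
    q′>0 = ⁻¹-pos (fromℕ-pos n) q#0
    q′*qx≈x : q′ * (q * x) ≈ x
    q′*qx≈x = begin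
      q′ * (q * x) ≈⟨ solve 3 (λ q′ q x → q′ :* (q :* x) := x :* (q :* q′)) ≈-refl q′ q x ⟩
      x * (q * q′) ≈⟨ *-congˡ (*-inverseʳ q q#0) ⟩
      x * 1#       ≈⟨ *-identityʳ x ⟩
      x            ∎
    from : q * x < fromℤ p ⊎ fromℤ p < q * x → x # fromℤ p / q [ q#0 ]
    from (inj₁ qx<p) = <⇒# (<-respˡ-≈ q′*qx≈x (<-respʳ-≈ (*-comm q′ _) (*-monoˡ-< q′>0 qx<p)))
    from (inj₂ p<qx) = #-sym (<⇒# (<-respˡ-≈ (*-comm q′ _) (<-respʳ-≈ q′*qx≈x (*-monoˡ-< q′>0 p<qx))))

  -- For irrational x the usual condition n ≤ x < n + 1 amounts to n < x < n + 1.
  floor-spec : ∀ {x} → Irrational x → ∃ λ n → fromℤ n < x × x < fromℤ n + 1#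
  floor-spec {x} irr = search (lo ℕ.+ hi) (ℤ.- (+ lo)) lower upper
    where
    search : ∀ k m → fromℤ m < x → x < fromℤ m + fromℕ k → ∃ λ n → fromℤ n < x × x < fromℤ n + 1#
    search zero    m m<x x<m =
      ⊥-elim (<-asym m<x (<-respʳ-≈ (+-identityʳ (fromℤ m)) x<m))
    search (suc k) m m<x x<m+k with irrational⇒< irr (ℤ.suc m) 0
    ... | inj₁ x<m+1 = m , m<x ,
      <-respˡ-≈ (*-identityˡ x) (<-respʳ-≈ (≈-trans (fromℤ-+ 1ℤ m) (+-comm 1# _)) x<m+1)
    ... | inj₂ m+1<x = search k (ℤ.suc m) (<-respʳ-≈ (*-identityˡ x) m+1<x)
      (<-respʳ-≈ (begin
        fromℤ m + fromℕ (suc k)       ≈⟨ +-congˡ (1+× k 1#) ⟩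
        fromℤ m + (1# + fromℕ k)      ≈⟨ solve 2 (λ m k → m :+ (con 1ℤ :+ k) := (con 1ℤ :+ m) :+ k)
                                           ≈-refl (fromℤ m) (fromℕ k) ⟩
        (1# + fromℤ m) + fromℕ k      ≈⟨ +-congʳ (fromℤ-+ 1ℤ m) ⟨
        fromℤ (ℤ.suc m) + fromℕ k     ∎) x<m+k)
    hi lo : ℕ
    hi = proj₁ (archimedean x)
    lo = proj₁ (archimedean (- x))
    lower : fromℤ (ℤ.- (+ lo)) < x
    lower = <-from-pos (<⇒pos (proj₂ (archimedean (- x))))
      (≈-trans (solve 2 (λ l x → l :- (:- x) := x :- (:- l)) ≈-refl (fromℕ lo) x)
        (+-congˡ (-‿cong (≈-sym (fromℤ-neg (+ lo))))))
    upper : x < fromℤ (ℤ.- (+ lo)) + fromℕ (lo ℕ.+ hi)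
    upper = <-respʳ-≈ (begin
      fromℕ hi                                   ≈⟨ solve 2 (λ l h → h := (:- l) :+ (l :+ h)) ≈-refl (fromℕ lo) (fromℕ hi) ⟩
      - fromℕ lo + (fromℕ lo + fromℕ hi)         ≈⟨ +-cong (fromℤ-neg (+ lo)) (×-homo-+ 1# lo hi) ⟨
      fromℤ (ℤ.- (+ lo)) + fromℕ (lo ℕ.+ hi)     ∎) (proj₂ (archimedean x))

  ⌊_⌋ : ∃ Irrational → ℤ
  ⌊ x , irr ⌋ = proj₁ (floor-spec irr)

  fractionalPart-pos : ∀ x → 0# < proj₁ x - fromℤ ⌊ x ⌋
  fractionalPart-pos (x , irr) = <⇒pos (proj₁ (proj₂ (floor-spec irr)))

  fractionalPart-<1 : ∀ x → proj₁ x - fromℤ ⌊ x ⌋ < 1#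
  fractionalPart-<1 (x , irr) = <-from-pos (<⇒pos (proj₂ (proj₂ (floor-spec irr))))
    (solve 2 (λ x n → (n :+ con 1ℤ) :- x := con 1ℤ :- (x :- n)) ≈-refl x _)

  reciprocalFractionalPart : ∃ Irrational → Carrier
  reciprocalFractionalPart x = 1# / (proj₁ x - fromℤ ⌊ x ⌋) [ >0⇒# (fractionalPart-pos x) ]

  private
    module Reciprocal (x : ∃ Irrational) where
      d y : Carrier
      d = proj₁ x - fromℤ ⌊ x ⌋
      y = reciprocalFractionalPart x

      y-pos : 0# < y
      y-pos = *-pos 0<1 (⁻¹-pos (fractionalPart-pos x) _)

      y*d≈1 : y * d ≈ 1#
      y*d≈1 = begin
        (1# * d′) * d ≈⟨ *-congʳ (*-identityˡ d′) ⟩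
        d′ * d        ≈⟨ *-comm d′ d ⟩
        d * d′        ≈⟨ *-inverseʳ d d#0 ⟩
        1#            ∎
        where
        d#0 : d # 0#
        d#0 = >0⇒# (fractionalPart-pos x)
        d′ : Carrier
        d′ = d ⁻¹[ d#0 ]

      y*[pd]≈p : ∀ p → y * (p * d) ≈ p
      y*[pd]≈p p = begin
        y * (p * d) ≈⟨ solve 3 (λ y p d → y :* (p :* d) := p :* (y :* d)) ≈-refl y p d ⟩
        p * (y * d) ≈⟨ *-congˡ y*d≈1 ⟩
        p * 1#      ≈⟨ *-identityʳ p ⟩
        p           ∎

      >1 : 1# < y
      >1 = <-respˡ-≈ y*d≈1 (<-respʳ-≈ (*-identityʳ y) (*-monoˡ-< y-pos (fractionalPart-<1 x)))

      below : ∀ {p q x n} → p * x < q + p * n → p * (x - n) < q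
      below {p} {q} {x} {n} h = <-from-pos (<⇒pos h)
        (solve 4 (λ p q x n → (q :+ p :* n) :- p :* x := q :- p :* (x :- n)) ≈-refl p q x n)

      above : ∀ {p q x n} → q + p * n < p * x → q < p * (x - n)
      above {p} {q} {x} {n} h = <-from-pos (<⇒pos h)
        (solve 4 (λ p q x n → p :* x :- (q :+ p :* n) := p :* (x :- n) :- q) ≈-refl p q x n)

      compare : ∀ p n → fromℕ (suc n) * y < fromℤ p ⊎ fromℤ p < fromℕ (suc n) * y
      compare +0 n = inj₂ (*-pos (fromℕ-pos n) y-pos)
      compare -[1+ m ] n = inj₂ (<-trans
        (<-from-pos (fromℕ-pos m) (solve 1 (λ m → m := con 0ℤ :- (:- m)) ≈-refl (fromℕ (suc m))))
        (*-pos (fromℕ-pos n) y-pos))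
      compare +[1+ m ] n = from (irrational⇒< (proj₂ x) r m)
        where
        r : ℤ
        r = +[1+ n ] ℤ.+ +[1+ m ] ℤ.* ⌊ x ⌋
        p q : Carrier
        p = fromℕ (suc m)
        q = fromℕ (suc n)
        r≈ : fromℤ r ≈ q + p * fromℤ ⌊ x ⌋
        r≈ = ≈-trans (fromℤ-+ +[1+ n ] (+[1+ m ] ℤ.* ⌊ x ⌋)) (+-congˡ (fromℤ-* +[1+ m ] ⌊ x ⌋))
        from : p * proj₁ x < fromℤ r ⊎ fromℤ r < p * proj₁ x → q * y < p ⊎ p < q * y
        from (inj₁ px<r) = inj₂ (<-respˡ-≈ (y*[pd]≈p p)
          (<-respʳ-≈ (*-comm y q) (*-monoˡ-< y-pos (below (<-respʳ-≈ r≈ px<r)))))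
        from (inj₂ r<px) = inj₁ (<-respʳ-≈ (y*[pd]≈p p)
          (<-respˡ-≈ (*-comm y q) (*-monoˡ-< y-pos (above (<-respˡ-≈ r≈ r<px)))))

  reciprocalFractionalPart-irrational : ∀ x → Irrational (reciprocalFractionalPart x)
  reciprocalFractionalPart-irrational x = irrational⇐< (Reciprocal.compare x)

  reciprocalFractionalPart->1 : ∀ x → 1# < reciprocalFractionalPart x
  reciprocalFractionalPart->1 x = Reciprocal.>1 x

  infixl 7 _*ᶜ_ _/ᶜ_[_]
  infixl 6 _+ᶜ_ _-ᶜ_
  infix  8 -ᶜ_
  infix  4 _≈ᶜ_ _+i_

  record ℂ : Set c where
    constructor _+i_
    field
      re im : Carrier
  open ℂ public

  _≈ᶜ_ : Rel ℂ ℓ₁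
  z ≈ᶜ w = re z ≈ re w × im z ≈ im w

  fromℝ : Carrier → ℂ
  fromℝ x = x +i 0#

  𝕚 : ℂ
  𝕚 = 0# +i 1#

  _+ᶜ_ _-ᶜ_ _*ᶜ_ : ℂ → ℂ → ℂ
  z +ᶜ w = re z + re w +i im z + im w
  z -ᶜ w = re z - re w +i im z - im w
  z *ᶜ w = re z * re w - im z * im w +i re z * im w + im z * re w

  -ᶜ_ : ℂ → ℂ
  -ᶜ z = - re z +i - im z

  _#0ᶜ : ℂ → Set ℓ₂
  z #0ᶜ = re z # 0# ⊎ im z # 0#

  ∣_∣² : ℂ → Carrier
  ∣ z ∣² = re z * re z + im z * im z

  private
    +-pos-nonneg : ∀ {x y} → 0# < x → ¬ (y < 0#) → 0# < x + y
    +-pos-nonneg {x} {y} 0<x y≮0 = from (#-cotrans (<⇒# 0<x) (x + y))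
      where
      y<0 : x + y < x → y < 0#
      y<0 h = <-from-pos (<⇒pos h) (solve 2 (λ x y → x :- (x :+ y) := con 0ℤ :- y) ≈-refl x y)
      from₁ : 0# < x + y ⊎ x + y < 0# → 0# < x + y
      from₁ (inj₁ 0<x+y) = 0<x+y
      from₁ (inj₂ x+y<0) = ⊥-elim (y≮0 (y<0 (<-trans x+y<0 0<x)))
      from₂ : x + y < x ⊎ x < x + y → 0# < x + y
      from₂ (inj₁ x+y<x) = ⊥-elim (y≮0 (y<0 x+y<x))
      from₂ (inj₂ x<x+y) = <-trans 0<x x<x+y
      from : 0# # x + y ⊎ x + y # x → 0# < x + y
      from (inj₁ h) = from₁ (#⇒< h)
      from (inj₂ h) = from₂ (#⇒< h)

  ∣∣²-pos : ∀ {z} → z #0ᶜ → 0# < ∣ z ∣²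
  ∣∣²-pos {z} (inj₁ re#0) = +-pos-nonneg (²-pos re#0) (²-nonneg (im z))
  ∣∣²-pos {z} (inj₂ im#0) =
    <-respʳ-≈ (+-comm _ _) (+-pos-nonneg (²-pos im#0) (²-nonneg (re z)))

  _/ᶜ_[_] : ∀ z w → w #0ᶜ → ℂ
  z /ᶜ w [ w#0 ] =
    (re z * re w + im z * im w) / ∣ w ∣² [ >0⇒# (∣∣²-pos w#0) ] +i
    (im z * re w - re z * im w) / ∣ w ∣² [ >0⇒# (∣∣²-pos w#0) ]

  4iπ_ : Carrier → ℂ
  4iπ t = fromℝ (fromℕ 4) *ᶜ 𝕚 *ᶜ fromℝ π *ᶜ fromℝ t

  [-1]^_ : ℕ → ℂ
  [-1]^ j = fromℝ ((- 1#) ^ j)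

  -- q + (-1)^j · 4iπt / d has real part q.
  re-q+4iπt/d : ∀ q j t d (d#0 : fromℝ d #0ᶜ) →
    re (fromℝ q +ᶜ [-1]^ j *ᶜ (4iπ t /ᶜ fromℝ d [ d#0 ])) ≈ q
  re-q+4iπt/d q j t d d#0 = scaled q ((- 1#) ^ j) d _ _ _ (imaginary (fromℕ 4) π t)
    where
    imaginary : ∀ f p t → re (fromℝ f *ᶜ 𝕚 *ᶜ fromℝ p *ᶜ fromℝ t) ≈ 0#
    imaginary = solve 3 (λ f p t →
      let o = con 0ℤ; l = con 1ℤ
          x = f :* o :- o :* l; y = f :* l :+ o :* o
      in (x :* p :- y :* o) :* t :- (x :* o :+ y :* p) :* o := o) ≈-refl
    scaled : ∀ q s d e x y → x ≈ 0# →
      q + (s * ((x * d + y * 0#) * e) - 0# * ((y * d - x * 0#) * e)) ≈ q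
    scaled q s d e x y x≈0 = begin
      q + (s * ((x * d + y * 0#) * e) - 0# * ((y * d - x * 0#) * e))
        ≈⟨ solve 6 (λ q s d e x y → let o = con 0ℤ in
             q :+ (s :* ((x :* d :+ y :* o) :* e) :- o :* ((y :* d :- x :* o) :* e)) := q :+ x :* (s :* d :* e))
             ≈-refl q s d e x y ⟩
      q + x * (s * d * e)   ≈⟨ +-congˡ (*-congʳ x≈0) ⟩
      q + 0# * (s * d * e)  ≈⟨ +-congˡ (zeroˡ _) ⟩
      q + 0#                ≈⟨ +-identityʳ q ⟩
      q                     ∎

  module ContinuedFraction (θ : Carrier) (θ-irrational : Irrational θ) where

    completeQuotient : ℕ → ∃ Irrational
    completeQuotient zero    = θ , θ-irrational
    completeQuotient (suc k) =
        reciprocalFractionalPart (completeQuotient k)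
      , reciprocalFractionalPart-irrational (completeQuotient k)

    θ[_] : ℕ → Carrier
    θ[ k ] = proj₁ (completeQuotient k)

    a[_] : ℕ → ℤ
    a[ k ] = ⌊ completeQuotient k ⌋

    -- q[ n -2] is the denominator with index n - 2, so the recursion starts at index -2.
    q[_-2] : ℕ → ℤ
    q[ zero -2]        = 1ℤ
    q[ suc zero -2]    = 0ℤ
    q[ suc (suc k) -2] = q[ k -2] ℤ.+ a[ k ] ℤ.* q[ suc k -2]

    q[_-1] q[_] : ℕ → ℤ
    q[ k -1] = q[ suc k -2]
    q[ k ]   = q[ suc (suc k) -2]

    θ-pos : ∀ k → 0# < θ[ suc k ]
    θ-pos k = <-trans 0<1 (reciprocalFractionalPart->1 (completeQuotient k))

    a-pos : ∀ k → 0ℤ ℤ.< a[ suc k ]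
    a-pos k = fromℤ-pos⁻¹ (positive (reciprocalFractionalPart->1 (completeQuotient k))
      (proj₂ (proj₂ (floor-spec (proj₂ (completeQuotient (suc k)))))))
      where
      positive : ∀ {x n} → 1# < x → x < n + 1# → 0# < n
      positive {x} {n} 1<x x<n+1 = <-from-pos (+-pos (<⇒pos 1<x) (<⇒pos x<n+1))
        (solve 2 (λ x n → (x :- con 1ℤ) :+ ((n :+ con 1ℤ) :- x) := n :- con 0ℤ) ≈-refl x n)

    q-pos : ∀ k → 0# < fromℤ q[ k ]
    q-pos zero          = <-respʳ-≈
      (≈-reflexive (≡.cong (λ n → fromℤ (1ℤ ℤ.+ n)) (≡.sym (ℤₚ.*-zeroʳ a[ 0 ])))) 0<1
    q-pos (suc zero)    = <-respʳ-≈ (≈-sym (begin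
        fromℤ (0ℤ ℤ.+ a[ 1 ] ℤ.* q[ 0 ])  ≡⟨ ≡.cong fromℤ (ℤₚ.+-identityˡ (a[ 1 ] ℤ.* q[ 0 ])) ⟩
        fromℤ (a[ 1 ] ℤ.* q[ 0 ])         ≈⟨ fromℤ-* a[ 1 ] q[ 0 ] ⟩
        fromℤ a[ 1 ] * fromℤ q[ 0 ]       ∎))
      (*-pos (fromℤ-pos (a-pos 0)) (q-pos 0))
    q-pos (suc (suc k)) = <-respʳ-≈ (≈-sym (begin
        fromℤ (q[ k ] ℤ.+ a[ suc (suc k) ] ℤ.* q[ suc k ])
          ≈⟨ fromℤ-+ q[ k ] _ ⟩
        fromℤ q[ k ] + fromℤ (a[ suc (suc k) ] ℤ.* q[ suc k ])
          ≈⟨ +-congˡ (fromℤ-* a[ suc (suc k) ] q[ suc k ]) ⟩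
        fromℤ q[ k ] + fromℤ a[ suc (suc k) ] * fromℤ q[ suc k ] ∎))
      (+-pos (q-pos k) (*-pos (fromℤ-pos (a-pos (suc k))) (q-pos (suc k))))

    q+θq-pos : ∀ j → 0# < fromℤ q[ j -2] + θ[ j ] * fromℤ q[ j -1]
    q+θq-pos zero          = <-respʳ-≈ (≈-sym (≈-trans (+-congˡ (zeroʳ θ)) (+-identityʳ 1#))) 0<1
    q+θq-pos (suc zero)    = <-respʳ-≈ (≈-sym (+-identityˡ _)) (*-pos (θ-pos 0) (q-pos 0))
    q+θq-pos (suc (suc j)) = +-pos (q-pos j) (*-pos (θ-pos (suc j)) (q-pos (suc j)))

    q+θq#0 : ∀ j → fromℝ (fromℤ q[ j -2] + θ[ j ] * fromℤ q[ j -1]) #0ᶜ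
    q+θq#0 j = inj₁ (>0⇒# (q+θq-pos j))

    τ-numerator τ-denominator : ℕ → Carrier → ℂ
    τ-numerator j t = fromℝ (fromℤ q[ j -1]) -ᶜ
      [-1]^ j *ᶜ (4iπ t /ᶜ fromℝ (fromℤ q[ j -2] + θ[ j ] * fromℤ q[ j -1]) [ q+θq#0 j ])
    τ-denominator j t = fromℝ (fromℤ q[ j ]) +ᶜ
      [-1]^ j *ᶜ (4iπ t /ᶜ fromℝ (fromℤ q[ j -1] + θ[ suc j ] * fromℤ q[ j ]) [ q+θq#0 (suc j) ])

    τ-denominator#0 : ∀ j t → τ-denominator j t #0ᶜ
    τ-denominator#0 j t = inj₁ (>0⇒# (<-respʳ-≈ (≈-sym (re-q+4iπt/d (fromℤ q[ j ]) j t _ (q+θq#0 (suc j)))) (q-pos j)))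

    τ : ℕ → Carrier → ℂ
    τ j t = -ᶜ ([-1]^ j) *ᶜ (τ-numerator j t /ᶜ τ-denominator j t [ τ-denominator#0 j t ])

{-# OPTIONS --safe #-}

-- Write w = 4iπt, s = (-1)^j and E_j = q_{j-2} + θ_j q_{j-1}.  Since
-- θ_{j+1} (θ_j - a_j) = 1, we have E_{j+1} = θ_{j+1} E_j, and hence
-- 1/E_j = a_{j+1}/E_{j+1} + 1/E_{j+2}.  With N_j and D_j the numerator and the
-- denominator in τ_j this says N_j + a_{j+1} D_j = D_{j+1}, while N_{j+1} = D_j.
-- So (τ_j - s a_{j+1}) τ_{j+1} = (-s D_{j+1} / D_j) (s D_j / D_{j+1}) = -1.

module Submission where

open import Algebra.Bundles using (CommutativeRing)
open import Algebra.Solver.Ring.AlmostCommutativeRing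
  using (AlmostCommutativeRing; fromCommutativeRing; _-Raw-AlmostCommutative⟶_)
import Algebra.Solver.Ring
open import Data.Integer.Base as ℤ using (0ℤ; 1ℤ)
import Data.Integer.Properties as ℤₚ
import Data.Maybe.Base as Maybe
open import Data.Nat.Base using (ℕ; zero; suc)
open import Data.Product.Base using (_,_)
open import Relation.Binary.PropositionalEquality.Core using (cong)
import Relation.Binary.Reasoning.Setoid
open import Relation.Nullary.Decidable.Core using (dec⇒maybe)
open import Defs

-- Commutative ring structure on the complex numbers.

module ComplexRing {c ℓ₁ ℓ₂} (ℝ : RealNumbers c ℓ₁ ℓ₂) where
  open Real ℝ
  open RingSolver

  -- Equality is componentwise, so the additive laws lift directly from the reals. The
  -- multiplicative laws become one polynomial identity for the real part and one for the imaginary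
  -- part, over the real coordinates.
  ℂ-commutativeRing : CommutativeRing c ℓ₁
  ℂ-commutativeRing = record
    { Carrier = ℂ
    ; _≈_     = _≈ᶜ_
    ; _+_     = _+ᶜ_
    ; _*_     = _*ᶜ_
    ; -_      = -ᶜ_
    ; 0#      = fromℝ 0#
    ; 1#      = fromℝ 1#
    ; isCommutativeRing = record
      { isRing = record
        { +-isAbelianGroup = record
          { isGroup = record
            { isMonoid = record
              { isSemigroup = record
                { isMagma = record
                  { isEquivalence = record
                    { refl  = ≈-refl , ≈-refl
                    ; sym   = λ (p , q) → ≈-sym p , ≈-sym q
                    ; trans = λ (p , q) (p′ , q′) → ≈-trans p p′ , ≈-trans q q′
                    }
                  ; ∙-cong = λ (p , q) (p′ , q′) → +-cong p p′ , +-cong q q′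
                  }
                ; assoc = λ x y z → +-assoc (re x) (re y) (re z) , +-assoc (im x) (im y) (im z)
                }
              ; identity = (λ x → +-identityˡ (re x) , +-identityˡ (im x))
                         , (λ x → +-identityʳ (re x) , +-identityʳ (im x))
              }
            ; inverse = (λ x → -‿inverseˡ (re x) , -‿inverseˡ (im x))
                      , (λ x → -‿inverseʳ (re x) , -‿inverseʳ (im x))
            ; ⁻¹-cong = λ (p , q) → -‿cong p , -‿cong q
            }
          ; comm = λ x y → +-comm (re x) (re y) , +-comm (im x) (im y)
          }
        ; *-cong = λ (p , q) (p′ , q′) →
              +-cong (*-cong p p′) (-‿cong (*-cong q q′))
            , +-cong (*-cong p q′) (*-cong q p′)
        ; *-assoc = λ x y z → *-assocᶜ (re x) (im x) (re y) (im y) (re z) (im z)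
        ; *-identity = (λ x → *-identityˡᶜ (re x) (im x)) , (λ x → *-identityʳᶜ (re x) (im x))
        ; distrib = (λ x y z → distribˡᶜ (re x) (im x) (re y) (im y) (re z) (im z))
                  , (λ x y z → distribʳᶜ (re x) (im x) (re y) (im y) (re z) (im z))
        }
      ; *-comm = λ x y → *-commᶜ (re x) (im x) (re y) (im y)
      }
    }
    where
    *-assocᶜ : ∀ a b c d e f →
      ((a +i b) *ᶜ (c +i d)) *ᶜ (e +i f) ≈ᶜ (a +i b) *ᶜ ((c +i d) *ᶜ (e +i f))
    *-assocᶜ a b c d e f =
        solve 6 (λ a b c d e f →
          (a :* c :- b :* d) :* e :- (a :* d :+ b :* c) :* f
            := a :* (c :* e :- d :* f) :- b :* (c :* f :+ d :* e)) ≈-refl a b c d e f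
      , solve 6 (λ a b c d e f →
          (a :* c :- b :* d) :* f :+ (a :* d :+ b :* c) :* e
            := a :* (c :* f :+ d :* e) :+ b :* (c :* e :- d :* f)) ≈-refl a b c d e f

    *-identityˡᶜ : ∀ a b → fromℝ 1# *ᶜ (a +i b) ≈ᶜ (a +i b)
    *-identityˡᶜ a b =
        solve 2 (λ a b → con 1ℤ :* a :- con 0ℤ :* b := a) ≈-refl a b
      , solve 2 (λ a b → con 1ℤ :* b :+ con 0ℤ :* a := b) ≈-refl a b

    *-commᶜ : ∀ a b c d → (a +i b) *ᶜ (c +i d) ≈ᶜ (c +i d) *ᶜ (a +i b)
    *-commᶜ a b c d =
        solve 4 (λ a b c d → a :* c :- b :* d := c :* a :- d :* b) ≈-refl a b c d
      , solve 4 (λ a b c d → a :* d :+ b :* c := c :* b :+ d :* a) ≈-refl a b c d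

    *-identityʳᶜ : ∀ a b → (a +i b) *ᶜ fromℝ 1# ≈ᶜ (a +i b)
    *-identityʳᶜ a b =
        solve 2 (λ a b → a :* con 1ℤ :- b :* con 0ℤ := a) ≈-refl a b
      , solve 2 (λ a b → a :* con 0ℤ :+ b :* con 1ℤ := b) ≈-refl a b

    distribˡᶜ : ∀ a b c d e f →
      (a +i b) *ᶜ ((c +i d) +ᶜ (e +i f)) ≈ᶜ (a +i b) *ᶜ (c +i d) +ᶜ (a +i b) *ᶜ (e +i f)
    distribˡᶜ a b c d e f =
        solve 6 (λ a b c d e f →
          a :* (c :+ e) :- b :* (d :+ f)
            := (a :* c :- b :* d) :+ (a :* e :- b :* f)) ≈-refl a b c d e f
      , solve 6 (λ a b c d e f →
          a :* (d :+ f) :+ b :* (c :+ e)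
            := (a :* d :+ b :* c) :+ (a :* f :+ b :* e)) ≈-refl a b c d e f

    distribʳᶜ : ∀ a b c d e f →
      ((c +i d) +ᶜ (e +i f)) *ᶜ (a +i b) ≈ᶜ (c +i d) *ᶜ (a +i b) +ᶜ (e +i f) *ᶜ (a +i b)
    distribʳᶜ a b c d e f =
        solve 6 (λ a b c d e f →
          (c :+ e) :* a :- (d :+ f) :* b
            := (c :* a :- d :* b) :+ (e :* a :- f :* b)) ≈-refl a b c d e f
      , solve 6 (λ a b c d e f →
          (c :+ e) :* b :+ (d :+ f) :* a
            := (c :* b :+ d :* a) :+ (e :* b :+ f :* a)) ≈-refl a b c d e f

  -- The embedding of the reals, and complex inverses.

  fromℝ-cong : ∀ {x y} → x ≈ y → fromℝ x ≈ᶜ fromℝ y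
  fromℝ-cong x≈y = x≈y , ≈-refl

  fromℝ-+ : ∀ x y → fromℝ (x + y) ≈ᶜ fromℝ x +ᶜ fromℝ y
  fromℝ-+ x y = ≈-refl , ≈-sym (+-identityˡ 0#)

  fromℝ-* : ∀ x y → fromℝ (x * y) ≈ᶜ fromℝ x *ᶜ fromℝ y
  fromℝ-* x y =
      solve 2 (λ x y → x :* y := x :* y :- con 0ℤ :* con 0ℤ) ≈-refl x y
    , solve 2 (λ x y → con 0ℤ := x :* con 0ℤ :+ con 0ℤ :* y) ≈-refl x y

  fromℝ-neg : ∀ x → fromℝ (- x) ≈ᶜ -ᶜ fromℝ x
  fromℝ-neg x = ≈-refl , solve 0 (con 0ℤ := :- con 0ℤ) ≈-refl

  -- The conjugate of `w` divided by its squared modulus. With the inverse as a separate factor, a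
  -- quotient becomes a product whose factors the ring solver can treat as variables.
  _⁻¹ᶜ[_] : ∀ w → w #0ᶜ → ℂ
  w ⁻¹ᶜ[ w#0 ] = re w * n +i (- im w) * n
    where n = ∣ w ∣² ⁻¹[ >0⇒# (∣∣²-pos w#0) ]

  /ᶜ≈*⁻¹ᶜ : ∀ z w (w#0 : w #0ᶜ) → z /ᶜ w [ w#0 ] ≈ᶜ z *ᶜ w ⁻¹ᶜ[ w#0 ]
  /ᶜ≈*⁻¹ᶜ z w w#0 =
      solve 5 (λ a b c d n → (a :* c :+ b :* d) :* n := a :* (c :* n) :- b :* ((:- d) :* n))
        ≈-refl (re z) (im z) (re w) (im w) _
    , solve 5 (λ a b c d n → (b :* c :- a :* d) :* n := a :* ((:- d) :* n) :+ b :* (c :* n))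
        ≈-refl (re z) (im z) (re w) (im w) _

  -- A number times its conjugate is its squared modulus, which `n` inverts; the imaginary cross
  -- terms cancel.
  *ᶜ-inverseʳ : ∀ w (w#0 : w #0ᶜ) → w *ᶜ w ⁻¹ᶜ[ w#0 ] ≈ᶜ fromℝ 1#
  *ᶜ-inverseʳ w w#0 =
      ≈-trans
        (solve 3 (λ a b n → a :* (a :* n) :- b :* ((:- b) :* n) := (a :* a :+ b :* b) :* n)
          ≈-refl (re w) (im w) _)
        (*-inverseʳ ∣ w ∣² (>0⇒# (∣∣²-pos w#0)))
    , solve 3 (λ a b n → a :* ((:- b) :* n) :+ b :* (a :* n) := con 0ℤ) ≈-refl (re w) (im w) _

  -- A solver for polynomial identities over the complex numbers.

  private
    ℂ-almostCommutativeRing : AlmostCommutativeRing c ℓ₁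
    ℂ-almostCommutativeRing = fromCommutativeRing ℂ-commutativeRing

    module ℂᵣ = CommutativeRing ℂ-commutativeRing

    ℤ⟶ℂ : ℤ.+-*-rawRing -Raw-AlmostCommutative⟶ ℂ-almostCommutativeRing
    ℤ⟶ℂ = record
      { ⟦_⟧    = λ i → fromℝ (fromℤ i)
      ; +-homo = λ i j → ℂᵣ.trans (fromℝ-cong (fromℤ-+ i j)) (fromℝ-+ _ _)
      ; *-homo = λ i j → ℂᵣ.trans (fromℝ-cong (fromℤ-* i j)) (fromℝ-* _ _)
      ; -‿homo = λ i → ℂᵣ.trans (fromℝ-cong (fromℤ-neg i)) (fromℝ-neg _)
      ; 0-homo = ℂᵣ.refl
      ; 1-homo = ℂᵣ.refl
      }

  -- Integers serve as coefficients because their equality is decidable.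
  module ℂ-RingSolver = Algebra.Solver.Ring ℤ.+-*-rawRing ℂ-almostCommutativeRing ℤ⟶ℂ
    (λ i j → Maybe.map (λ i≡j → ℂᵣ.reflexive (cong (λ k → fromℝ (fromℤ k)) i≡j))
                       (dec⇒maybe (i ℤₚ.≟ j)))

module Recurrence {c ℓ₁ ℓ₂} (ℝ : RealNumbers c ℓ₁ ℓ₂)
  (θ : Real.Carrier ℝ) (θ-irrational : Real.Irrational ℝ θ) where
  open Real ℝ
  open ContinuedFraction θ θ-irrational
  open ComplexRing ℝ
  private module ℂᵣ = CommutativeRing ℂ-commutativeRing

  -- Recurrences for E_j and its reciprocal.

  E : ℕ → Carrier
  E j = fromℤ q[ j -2] + θ[ j ] * fromℤ q[ j -1]

  -- Inverted in `ℂ` rather than among the reals, because the quotients inside `τ` are complex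
  -- divisions by `fromℝ (E j)`.
  E⁻¹ : ℕ → ℂ
  E⁻¹ j = fromℝ (E j) ⁻¹ᶜ[ q+θq#0 j ]

  fromℤ-q : ∀ j → fromℤ q[ j ] ≈ fromℤ q[ j -2] + fromℤ a[ j ] * fromℤ q[ j -1]
  fromℤ-q j = ≈-trans (fromℤ-+ q[ j -2] _) (+-congˡ (fromℤ-* a[ j ] q[ j -1]))

  θ[1+j]*[θ[j]-a[j]]≈1 : ∀ j → θ[ suc j ] * (θ[ j ] - fromℤ a[ j ]) ≈ 1#
  θ[1+j]*[θ[j]-a[j]]≈1 j = begin
    (1# * d⁻¹) * d ≈⟨ *-congʳ (*-identityˡ d⁻¹) ⟩
    d⁻¹ * d        ≈⟨ *-comm d⁻¹ d ⟩
    d * d⁻¹        ≈⟨ *-inverseʳ d _ ⟩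
    1#             ∎
    where
    open Relation.Binary.Reasoning.Setoid setoid
    d d⁻¹ : Carrier
    d   = θ[ j ] - fromℤ a[ j ]
    d⁻¹ = d ⁻¹[ >0⇒# (fractionalPart-pos (completeQuotient j)) ]

  -- Writing the coefficient 1 of q_{j-1} as θ_{j+1} (θ_j - a_j) makes θ_{j+1} a common factor, and
  -- the a_j terms cancel against those of q_j.
  E[1+j]≈θ[1+j]*E[j] : ∀ j → E (suc j) ≈ θ[ suc j ] * E j
  E[1+j]≈θ[1+j]*E[j] j = begin
    q₁ + θ′ * fromℤ q[ j ]            ≈⟨ +-cong (≈-sym (*-identityˡ q₁)) (*-congˡ (fromℤ-q j)) ⟩
    1# * q₁ + θ′ * (q₂ + a * q₁)      ≈⟨ +-congʳ (*-congʳ (θ[1+j]*[θ[j]-a[j]]≈1 j)) ⟨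
    θ′ * (θj - a) * q₁ + θ′ * (q₂ + a * q₁)
      ≈⟨ solve 5 (λ θ′ θ a q₁ q₂ →
           θ′ :* (θ :- a) :* q₁ :+ θ′ :* (q₂ :+ a :* q₁) := θ′ :* (q₂ :+ θ :* q₁))
           ≈-refl θ′ θj a q₁ q₂ ⟩
    θ′ * (q₂ + θj * q₁)               ∎
    where
    open Relation.Binary.Reasoning.Setoid setoid
    open RingSolver
    q₁ q₂ a θj θ′ : Carrier
    q₁ = fromℤ q[ j -1]
    q₂ = fromℤ q[ j -2]
    a  = fromℤ a[ j ]
    θj = θ[ j ]
    θ′ = θ[ suc j ]

  open Relation.Binary.Reasoning.Setoid ℂᵣ.setoid
  open ℂ-RingSolver

  -- Multiplying by E_{j+1} / E_{j+1} and replacing the upper E_{j+1} by θ_{j+1} E_j lets E_j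
  -- cancel, so θ_{j+1} itself is never inverted.
  E⁻¹[j]≈θ[1+j]*E⁻¹[1+j] : ∀ j → E⁻¹ j ≈ᶜ fromℝ θ[ suc j ] *ᶜ E⁻¹ (suc j)
  E⁻¹[j]≈θ[1+j]*E⁻¹[1+j] j = begin
    E⁻¹ j                                 ≈⟨ ℂᵣ.*-identityʳ _ ⟨
    E⁻¹ j *ᶜ fromℝ 1#                     ≈⟨ ℂᵣ.*-congˡ (*ᶜ-inverseʳ _ (q+θq#0 (suc j))) ⟨
    E⁻¹ j *ᶜ (fromℝ (E (suc j)) *ᶜ E⁻¹ (suc j))
      ≈⟨ ℂᵣ.*-congˡ (ℂᵣ.*-congʳ
           (ℂᵣ.trans (fromℝ-cong (E[1+j]≈θ[1+j]*E[j] j)) (fromℝ-* _ _))) ⟩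
    E⁻¹ j *ᶜ (θ′ *ᶜ fromℝ (E j) *ᶜ E⁻¹ (suc j))
      ≈⟨ solve 4 (λ e θ′ E e′ → e :* (θ′ :* E :* e′) := E :* e :* (θ′ :* e′)) ℂᵣ.refl
           (E⁻¹ j) θ′ (fromℝ (E j)) (E⁻¹ (suc j)) ⟩
    fromℝ (E j) *ᶜ E⁻¹ j *ᶜ (θ′ *ᶜ E⁻¹ (suc j))
      ≈⟨ ℂᵣ.*-congʳ (*ᶜ-inverseʳ _ (q+θq#0 j)) ⟩
    fromℝ 1# *ᶜ (θ′ *ᶜ E⁻¹ (suc j))       ≈⟨ ℂᵣ.*-identityˡ _ ⟩
    θ′ *ᶜ E⁻¹ (suc j)                     ∎
    where
    θ′ : ℂ
    θ′ = fromℝ θ[ suc j ]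

  -- Split θ_{j+1} into its floor a_{j+1} and its fractional part `d`; the floor gives the first
  -- term.
  E⁻¹-recurrence : ∀ j → E⁻¹ j ≈ᶜ fromℝ (fromℤ a[ suc j ]) *ᶜ E⁻¹ (suc j) +ᶜ E⁻¹ (suc (suc j))
  E⁻¹-recurrence j = begin
    E⁻¹ j                          ≈⟨ E⁻¹[j]≈θ[1+j]*E⁻¹[1+j] j ⟩
    θ₁ *ᶜ e₁                       ≈⟨ solve 3 (λ θ a e → θ :* e := a :* e :+ (θ :+ :- a) :* e)
                                        ℂᵣ.refl θ₁ a e₁ ⟩
    -- Passing to the next index brings in the factor θ_{j+2}, the reciprocal of `d`.
    a *ᶜ e₁ +ᶜ d *ᶜ e₁             ≈⟨ ℂᵣ.+-congˡ (ℂᵣ.*-congˡ (E⁻¹[j]≈θ[1+j]*E⁻¹[1+j] (suc j))) ⟩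
    a *ᶜ e₁ +ᶜ d *ᶜ (θ₂ *ᶜ e₂)     ≈⟨ solve 5 (λ a e₁ d θ₂ e₂ →
                                        a :* e₁ :+ d :* (θ₂ :* e₂) := a :* e₁ :+ (θ₂ :* d) :* e₂)
                                        ℂᵣ.refl a e₁ d θ₂ e₂ ⟩
    a *ᶜ e₁ +ᶜ (θ₂ *ᶜ d) *ᶜ e₂     ≈⟨ ℂᵣ.+-congˡ (ℂᵣ.*-congʳ θ₂*d≈1) ⟩
    a *ᶜ e₁ +ᶜ fromℝ 1# *ᶜ e₂      ≈⟨ ℂᵣ.+-congˡ (ℂᵣ.*-identityˡ e₂) ⟩
    a *ᶜ e₁ +ᶜ e₂                  ∎
    where
    a d θ₁ θ₂ e₁ e₂ : ℂ
    a  = fromℝ (fromℤ a[ suc j ])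
    θ₁ = fromℝ θ[ suc j ]
    d  = θ₁ +ᶜ -ᶜ a
    θ₂ = fromℝ θ[ suc (suc j) ]
    e₁ = E⁻¹ (suc j)
    e₂ = E⁻¹ (suc (suc j))
    θ₂*d≈1 : θ₂ *ᶜ d ≈ᶜ fromℝ 1#
    θ₂*d≈1 = begin
      θ₂ *ᶜ (θ₁ +ᶜ -ᶜ a)
        ≈⟨ ℂᵣ.*-congˡ (ℂᵣ.trans (fromℝ-+ _ _) (ℂᵣ.+-congˡ (fromℝ-neg _))) ⟨
      θ₂ *ᶜ fromℝ (θ[ suc j ] - fromℤ a[ suc j ])  ≈⟨ fromℝ-* _ _ ⟨
      fromℝ (θ[ suc (suc j) ] * (θ[ suc j ] - fromℤ a[ suc j ]))
        ≈⟨ fromℝ-cong (θ[1+j]*[θ[j]-a[j]]≈1 (suc j)) ⟩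
      fromℝ 1#                                     ∎

  -- Alternating signs.

  [-1]^-suc : ∀ j → [-1]^ (suc j) ≈ᶜ -ᶜ ([-1]^ j)
  [-1]^-suc j =
    ℂᵣ.trans (fromℝ-* _ _)
      (ℂᵣ.trans (ℂᵣ.*-congʳ (fromℝ-neg 1#))
        (solve 1 (λ s → (:- con 1ℤ) :* s := :- s) ℂᵣ.refl ([-1]^ j)))

  [-1]^-square : ∀ j → [-1]^ j *ᶜ [-1]^ j ≈ᶜ fromℝ 1#
  [-1]^-square zero    = ℂᵣ.*-identityˡ (fromℝ 1#)
  [-1]^-square (suc j) = begin
    [-1]^ (suc j) *ᶜ [-1]^ (suc j)   ≈⟨ ℂᵣ.*-cong ([-1]^-suc j) ([-1]^-suc j) ⟩
    -ᶜ ([-1]^ j) *ᶜ -ᶜ ([-1]^ j)     ≈⟨ solve 1 (λ s → (:- s) :* (:- s) := s :* s) ℂᵣ.refl ([-1]^ j) ⟩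
    [-1]^ j *ᶜ [-1]^ j               ≈⟨ [-1]^-square j ⟩
    fromℝ 1#                         ∎

  -- Numerators and denominators of consecutive `τ`.

  numerator≈ : ∀ j t →
    τ-numerator j t ≈ᶜ fromℝ (fromℤ q[ j -1]) +ᶜ -ᶜ ([-1]^ j *ᶜ (4iπ t *ᶜ E⁻¹ j))
  numerator≈ j t =
    ℂᵣ.+-congˡ (ℂᵣ.-‿cong (ℂᵣ.*-congˡ {x = [-1]^ j} (/ᶜ≈*⁻¹ᶜ (4iπ t) _ (q+θq#0 j))))

  denominator≈ : ∀ j t →
    τ-denominator j t ≈ᶜ fromℝ (fromℤ q[ j ]) +ᶜ [-1]^ j *ᶜ (4iπ t *ᶜ E⁻¹ (suc j))
  denominator≈ j t =
    ℂᵣ.+-congˡ (ℂᵣ.*-congˡ {x = [-1]^ j} (/ᶜ≈*⁻¹ᶜ (4iπ t) _ (q+θq#0 (suc j))))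

  -- Both sides involve the same q_j and E_{j+1}; the sign change from j to j + 1 absorbs the minus
  -- sign of the numerator.
  numerator-suc : ∀ j t → τ-numerator (suc j) t ≈ᶜ τ-denominator j t
  numerator-suc j t = begin
    τ-numerator (suc j) t                   ≈⟨ numerator≈ (suc j) t ⟩
    q +ᶜ -ᶜ ([-1]^ (suc j) *ᶜ x)            ≈⟨ ℂᵣ.+-congˡ (ℂᵣ.-‿cong (ℂᵣ.*-congʳ ([-1]^-suc j))) ⟩
    q +ᶜ -ᶜ (-ᶜ ([-1]^ j) *ᶜ x)             ≈⟨ solve 3 (λ q s x → q :+ :- ((:- s) :* x) := q :+ s :* x)
                                                 ℂᵣ.refl q ([-1]^ j) x ⟩
    q +ᶜ [-1]^ j *ᶜ x                       ≈⟨ denominator≈ j t ⟨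
    τ-denominator j t                       ∎
    where
    q x : ℂ
    q = fromℝ (fromℤ q[ j ])
    x = 4iπ t *ᶜ E⁻¹ (suc j)

  -- The real terms combine by the recursion for q_{j+1}, the imaginary ones by the recurrence for
  -- 1/E_j.
  denominator-suc : ∀ j t →
    τ-numerator j t +ᶜ fromℝ (fromℤ a[ suc j ]) *ᶜ τ-denominator j t ≈ᶜ τ-denominator (suc j) t
  denominator-suc j t = begin
    τ-numerator j t +ᶜ a *ᶜ τ-denominator j t
      ≈⟨ ℂᵣ.+-cong (numerator≈ j t) (ℂᵣ.*-congˡ (denominator≈ j t)) ⟩
    (q₁ +ᶜ -ᶜ (s *ᶜ (w *ᶜ E⁻¹ j))) +ᶜ a *ᶜ (q₀ +ᶜ s *ᶜ (w *ᶜ e₁))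
      ≈⟨ ℂᵣ.+-congʳ (ℂᵣ.+-congˡ (ℂᵣ.-‿cong (ℂᵣ.*-congˡ (ℂᵣ.*-congˡ (E⁻¹-recurrence j))))) ⟩
    (q₁ +ᶜ -ᶜ (s *ᶜ (w *ᶜ (a *ᶜ e₁ +ᶜ e₂)))) +ᶜ a *ᶜ (q₀ +ᶜ s *ᶜ (w *ᶜ e₁))
      -- The two terms `s w a e₁` cancel; the remaining `e₂` term carries the sign -s = (-1)^{j+1}.
      ≈⟨ solve 7 (λ q₁ q₀ s w a e₁ e₂ →
           (q₁ :+ :- (s :* (w :* (a :* e₁ :+ e₂)))) :+ a :* (q₀ :+ s :* (w :* e₁))
             := (q₁ :+ a :* q₀) :+ (:- s) :* (w :* e₂))
           ℂᵣ.refl q₁ q₀ s w a e₁ e₂ ⟩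
    (q₁ +ᶜ a *ᶜ q₀) +ᶜ -ᶜ s *ᶜ (w *ᶜ e₂)
      ≈⟨ ℂᵣ.+-cong (ℂᵣ.trans (fromℝ-cong (fromℤ-q (suc j)))
                     (ℂᵣ.trans (fromℝ-+ _ _) (ℂᵣ.+-congˡ (fromℝ-* _ _))))
                   (ℂᵣ.*-congʳ ([-1]^-suc j)) ⟨
    fromℝ (fromℤ q[ suc j ]) +ᶜ [-1]^ (suc j) *ᶜ (w *ᶜ e₂)
      ≈⟨ denominator≈ (suc j) t ⟨
    τ-denominator (suc j) t ∎
    where
    q₁ q₀ s w a e₁ e₂ : ℂ
    q₁ = fromℝ (fromℤ q[ j -1])
    q₀ = fromℝ (fromℤ q[ j ])
    s  = [-1]^ j
    w  = 4iπ t
    a  = fromℝ (fromℤ a[ suc j ])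
    e₁ = E⁻¹ (suc j)
    e₂ = E⁻¹ (suc (suc j))

  -- The product of the shifted `τ j t` with its successor.

  τ-recurrence : ∀ j t →
    (τ j t -ᶜ [-1]^ j *ᶜ fromℝ (fromℤ a[ suc j ])) *ᶜ τ (suc j) t ≈ᶜ -ᶜ fromℝ 1#
  τ-recurrence j t = begin
    (τ j t +ᶜ -ᶜ (s *ᶜ a)) *ᶜ τ (suc j) t
      ≈⟨ ℂᵣ.*-cong (ℂᵣ.+-congʳ τⱼ≈) τ₁₊ⱼ≈ ⟩
    (-ᶜ s *ᶜ (N *ᶜ u) +ᶜ -ᶜ (s *ᶜ a)) *ᶜ (s *ᶜ (D *ᶜ v))
      -- Moving the right-hand `D` into the bracket pairs it with its inverse `u` in one term and
      -- leaves `a D` in the other; the signs collect into `s * s`.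
      ≈⟨ solve 6 (λ s N u a D v →
           ((:- s) :* (N :* u) :+ :- (s :* a)) :* (s :* (D :* v))
             := :- ((s :* s) :* ((N :* (D :* u) :+ a :* D) :* v)))
           ℂᵣ.refl s N u a D v ⟩
    -ᶜ ((s *ᶜ s) *ᶜ ((N *ᶜ (D *ᶜ u) +ᶜ a *ᶜ D) *ᶜ v))
      ≈⟨ ℂᵣ.-‿cong (ℂᵣ.*-cong ([-1]^-square j) (ℂᵣ.*-congʳ (ℂᵣ.+-congʳ
           (ℂᵣ.trans (ℂᵣ.*-congˡ (*ᶜ-inverseʳ D (τ-denominator#0 j t))) (ℂᵣ.*-identityʳ N))))) ⟩
    -ᶜ (fromℝ 1# *ᶜ ((N +ᶜ a *ᶜ D) *ᶜ v))
      -- The bracket is now exactly the next denominator, which `v` inverts.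
      ≈⟨ ℂᵣ.-‿cong (ℂᵣ.trans (ℂᵣ.*-identityˡ _) (ℂᵣ.*-congʳ (denominator-suc j t))) ⟩
    -ᶜ (τ-denominator (suc j) t *ᶜ v)
      ≈⟨ ℂᵣ.-‿cong (*ᶜ-inverseʳ _ (τ-denominator#0 (suc j) t)) ⟩
    -ᶜ fromℝ 1# ∎
    where
    s a N D u v : ℂ
    s = [-1]^ j
    a = fromℝ (fromℤ a[ suc j ])
    N = τ-numerator j t
    D = τ-denominator j t
    u = D ⁻¹ᶜ[ τ-denominator#0 j t ]
    v = τ-denominator (suc j) t ⁻¹ᶜ[ τ-denominator#0 (suc j) t ]

    τⱼ≈ : τ j t ≈ᶜ -ᶜ s *ᶜ (N *ᶜ u)
    τⱼ≈ = ℂᵣ.*-congˡ (/ᶜ≈*⁻¹ᶜ N D (τ-denominator#0 j t))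

    -- The leading sign -(-1)^{j+1} equals `s`, and the numerator at j + 1 is the denominator `D` at
    -- j, which prepares the cancellation with `u`.
    τ₁₊ⱼ≈ : τ (suc j) t ≈ᶜ s *ᶜ (D *ᶜ v)
    τ₁₊ⱼ≈ = ℂᵣ.*-cong
      (ℂᵣ.trans (ℂᵣ.-‿cong ([-1]^-suc j)) (solve 1 (λ s → :- (:- s) := s) ℂᵣ.refl s))
      (ℂᵣ.trans (/ᶜ≈*⁻¹ᶜ _ _ (τ-denominator#0 (suc j) t)) (ℂᵣ.*-congʳ (numerator-suc j t)))

theorem6p1 : ∀ {c ℓ₁ ℓ₂} (ℝ : RealNumbers c ℓ₁ ℓ₂) →
    let open Real ℝ in
    (θ : Carrier) (θ-irrational : Irrational θ) →
    let open ContinuedFraction θ θ-irrational in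
    (j : ℕ) (t : Carrier) → 0# < t →
    (τ j t -ᶜ [-1]^ j *ᶜ fromℝ (fromℤ a[ suc j ])) *ᶜ τ (suc j) t ≈ᶜ -ᶜ fromℝ 1#
theorem6p1 ℝ θ θ-irrational j t _ = Recurrence.τ-recurrence ℝ θ θ-irrational j t
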